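{- Let $G$ be a graph embedded on an orientable surface without boundary such that every face is homeomorphic to an open disc and every edge lies on the boundary of two distinct faces, let $\alpha$ be strongly connected, and let $\mathcal F=\{F_1,\dots,F_{|\mathcal F|}\}$ be the facial circuits. Let $\mathbf D(\emptyset)$ be the flip graph of $\alpha$-orientations and $\mathbf c$ its edge coloring by face type, as described below. Then $\mathbf c$ is both a U-coloring and an L-coloring of $\mathbf D(\emptyset)$.
   Context: Under the embedding assumptions, each face is bounded by a circuit (facial circuit), and every edge lies on exactly two distinct facial circuits. For $\alpha:V(G)\to\mathbb Z_{\ge 0}$, an $\alpha$-orientation is an orientation of $G$ in which every vertex $v$ has out-degree $\alpha(v)$; $\alpha$ is strongly connected if (some, equivalently every) $\alpha$-orientation is strongly connected. A directed facial circuit is counterclockwise (ccw) if, traversing it along its direction, its face lies to the left. A flip on a ccw facial circuit $F$ reverses the direction of all edges of $F$ (making it clockwise). $\mathbf D(\emptyset)$ is the directed graph whose vertices are all $\alpha$-orientations of $G$, with a directed edge from $D'$ to $D$ whenever $D$ is obtained from $D'$ by a flip; such an edge has type $F_i$ if the flip is on $F_i$, $\mathbf E_i$ is the set of edges of type $F_i$, and $\mathbf c(\mathbf e)=i$ for $\mathbf e\in\mathbf E_i$. For a digraph with edge coloring $c$, where $(u,v)$ denotes an edge from $u$ to $v$: $c$ is a U-coloring if for all vertices $u,v,w$ with $u\ne w$ and edges $(v,u),(v,w)$: (U1) $c(v,u)\ne c(v,w)$, and (U2) there is a vertex $z$ and edges $(u,z),(w,z)$ with $c(v,u)=c(w,z)$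 and $c(v,w)=c(u,z)$. An L-coloring is defined identically with every edge $(i,j)$ in this definition replaced by $(j,i)$. -}

module Defs where

open import Data.Nat using (ℕ)
open import Data.Bool using (Bool; true; false; not; _∧_)
open import Data.Fin using (Fin; _≟_)
open import Data.Vec using (Vec; lookup)
open import Data.List using (List; length; filterᵇ)
open import Data.List.Base using () renaming (allFin to allFinL)
open import Data.Product using (Σ; ∃; _×_; _,_; proj₁)
open import Function using (_∘_)
open import Relation.Nullary using (¬_; does)
open import Relation.Binary.PropositionalEquality using (_≡_; _≢_)
open import Relation.Binary.Construct.Closure.ReflexiveTransitive using (Star)

iter : ∀ {A : Set} → (A → A) → ℕ → A → A
iter f ℕ.zero x = x
iter f (ℕ.suc k) x = f (iter f k x)

-- A graph cellularly embedded in a closed orientable surface, given as a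
-- combinatorial map (rotation system).  Darts are Fin nD; each edge is a
-- pair {d , σ d} of darts; vert d is the tail vertex of dart d; ρ is the
-- rotation at the vertices; φ d = ρ (σ d) is the face permutation, and
-- face d ∈ Fin nF is the index of the face lying to the LEFT of dart d
-- (convention fixing the orientation of the surface).  Faces F_1..F_nF
-- are the φ-orbits, vertices are the ρ-orbits.
record EmbeddedGraph : Set where
  field
    nV nD nF : ℕ
    σ : Fin nD → Fin nD
    σ-invol : ∀ d → σ (σ d) ≡ d
    σ-nofix : ∀ d → σ d ≢ d
    ρ ρ⁻¹ : Fin nD → Fin nD
    ρ-inv₁ : ∀ d → ρ (ρ⁻¹ d) ≡ d
    ρ-inv₂ : ∀ d → ρ⁻¹ (ρ d) ≡ d
    vert : Fin nD → Fin nV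
    vert-ρ : ∀ d → vert (ρ d) ≡ vert d
    vert-orbit : ∀ d d' → vert d ≡ vert d' → ∃ λ k → iter ρ k d ≡ d'
    vert-surj : ∀ v → ∃ λ d → vert d ≡ v
    face : Fin nD → Fin nF
    face-φ : ∀ d → face (ρ (σ d)) ≡ face d
    face-orbit : ∀ d d' → face d ≡ face d' → ∃ λ k → iter (ρ ∘ σ) k d ≡ d'
    face-surj : ∀ i → ∃ λ d → face d ≡ i
    -- each face is bounded by a circuit: its boundary walk never revisits a vertex
    facial-circuit : ∀ d d' → face d ≡ face d' → vert d ≡ vert d' → d ≡ d'
    two-faces : ∀ d → face (σ d) ≢ face d

module _ (G : EmbeddedGraph) where
  open EmbeddedGraph G

  -- an orientation: for each dart, whether the edge is directed along it
  Orientation : Set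
  Orientation = Vec Bool nD

  IsOrientation : Orientation → Set
  IsOrientation o = ∀ d → lookup o (σ d) ≡ not (lookup o d)

  outdeg : Orientation → Fin nV → ℕ
  outdeg o v = length (filterᵇ (λ d → lookup o d ∧ does (vert d ≟ v)) (allFinL nD))

  IsAlphaOrientation : (Fin nV → ℕ) → Orientation → Set
  IsAlphaOrientation α o = IsOrientation o × (∀ v → outdeg o v ≡ α v)

  Arc : Orientation → Fin nV → Fin nV → Set
  Arc o u v = ∃ λ d → vert d ≡ u × vert (σ d) ≡ v × lookup o d ≡ true

  IsStronglyConnected : Orientation → Set
  IsStronglyConnected o = ∀ u v → Star (Arc o) u v

  StronglyConnectedα : (Fin nV → ℕ) → Set
  StronglyConnectedα α = ∃ λ o → IsAlphaOrientation α o × IsStronglyConnected o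

  -- face i is a counterclockwise directed facial circuit in o
  -- (every edge of it is directed so that face i is on its left)
  IsCCW : Fin nF → Orientation → Set
  IsCCW i o = ∀ d → face d ≡ i → lookup o d ≡ true

  Flip : Fin nF → Orientation → Orientation → Set
  Flip i o' o = IsCCW i o'
              × (∀ d → face d ≡ i → lookup o d ≡ false)
              × (∀ d → face d ≢ i → face (σ d) ≢ i → lookup o d ≡ lookup o' d)

  -- edges of type F_i of the flip graph D(∅) from o' to o
  -- (vertices of D(∅) are the α-orientations; other vectors are isolated)
  FlipEdge : (Fin nV → ℕ) → Fin nF → Orientation → Orientation → Set
  FlipEdge α i o' o = IsAlphaOrientation α o' × IsAlphaOrientation α o × Flip i o' o

  -- the edge set of D(∅), with c(e) = proj₁ e
  DEdge : (Fin nV → ℕ) → Orientation → Orientation → Set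
  DEdge α o' o = Σ (Fin nF) λ i → FlipEdge α i o' o

IsUColoring : {V C : Set} (E : V → V → Set) (c : ∀ {u v} → E u v → C) → Set
IsUColoring {V} E c =
  ∀ {u v w : V} → u ≢ w → (e₁ : E v u) (e₂ : E v w) →
    c e₁ ≢ c e₂ ×
    ∃ λ (z : V) → Σ (E u z) λ e₃ → Σ (E w z) λ e₄ → c e₁ ≡ c e₄ × c e₂ ≡ c e₃

reverse : {V : Set} → (V → V → Set) → V → V → Set
reverse E u v = E v u

IsLColoring : {V C : Set} (E : V → V → Set) (c : ∀ {u v} → E u v → C) → Set
IsLColoring E c = IsUColoring (reverse E) c

-- Flipping the facial circuit i is the involution flipFace i of orientations that
-- toggles every dart of an edge bounded by face i; these involutions commute.  If two
-- flips on faces i ≠ j both start (or both end) at an orientation v, both faces are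
-- directed the same way in v, so they share no edge (a common edge would be directed
-- both ways).
-- Hence at every dart the four orientations v, flipFace i v, flipFace j v and
-- z = flipFace j (flipFace i v) satisfy [z] + [v] = [flipFace i v] + [flipFace j v],
-- and summing over the darts at a vertex shows that z is again an α-orientation.  The
-- flips on i and j from the two neighbours then meet in z, which gives U2, and U1
-- holds because a flip is determined by its face.  Reversing all arrows gives L.
module Submission where

open import Defs
open import Data.Nat using (ℕ; _+_)
open import Data.Nat.Properties using (+-comm; +-cancelʳ-≡; +-commutativeSemigroup)
open import Algebra.Properties.CommutativeSemigroup +-commutativeSemigroup using (interchange)
open import Data.Bool using (Bool; true; false; not; _∧_; _xor_)
open import Data.Bool.Properties
  using (∧-identityʳ; ∧-zeroʳ; ∨-comm; not-involutive; not-¬; xor-assoc; xor-comm; xor-same; not-distribʳ-xor)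
open import Data.Fin using (Fin; _≟_)
open import Data.List using (List; []; _∷_; length; filterᵇ)
open import Data.List.Base using () renaming (allFin to allFinL)
open import Data.Vec using (lookup; tabulate)
open import Data.Vec.Properties using (lookup∘tabulate)
open import Data.Vec.Relation.Binary.Pointwise.Extensional using (ext; Pointwise-≡⇒≡)
open import Data.Product using (_×_; _,_; proj₁)
open import Data.Sum using (_⊎_; inj₁; inj₂; [_,_])
open import Function using (_∘_)
open import Relation.Nullary using (¬_; Dec; does; yes; no)
open import Relation.Nullary.Decidable using (dec-true; dec-false; _⊎-dec_)
open import Relation.Binary.PropositionalEquality
  using (_≡_; _≢_; refl; sym; trans; cong; cong₂; subst; module ≡-Reasoning)
open ≡-Reasoning

bool→ℕ : Bool → ℕ
bool→ℕ true  = 1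
bool→ℕ false = 0

length-filterᵇ-∷ : ∀ {A : Set} (p : A → Bool) x xs →
  length (filterᵇ p (x ∷ xs)) ≡ bool→ℕ (p x) + length (filterᵇ p xs)
length-filterᵇ-∷ p x xs with p x
... | true  = refl
... | false = refl

length-filterᵇ-balance : ∀ {A : Set} (p q r s : A → Bool) →
  (∀ x → bool→ℕ (p x) + bool→ℕ (q x) ≡ bool→ℕ (r x) + bool→ℕ (s x)) → ∀ xs →
  length (filterᵇ p xs) + length (filterᵇ q xs) ≡ length (filterᵇ r xs) + length (filterᵇ s xs)
length-filterᵇ-balance p q r s balance [] = refl
length-filterᵇ-balance {A} p q r s balance (x ∷ xs) = begin
  # p (x ∷ xs) + # q (x ∷ xs)
    ≡⟨ cong₂ _+_ (length-filterᵇ-∷ p x xs) (length-filterᵇ-∷ q x xs) ⟩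
  (bool→ℕ (p x) + # p xs) + (bool→ℕ (q x) + # q xs)
    ≡⟨ interchange (bool→ℕ (p x)) _ _ _ ⟩
  (bool→ℕ (p x) + bool→ℕ (q x)) + (# p xs + # q xs)
    ≡⟨ cong₂ _+_ (balance x) (length-filterᵇ-balance p q r s balance xs) ⟩
  (bool→ℕ (r x) + bool→ℕ (s x)) + (# r xs + # s xs)
    ≡⟨ interchange (bool→ℕ (r x)) _ _ _ ⟩
  (bool→ℕ (r x) + # r xs) + (bool→ℕ (s x) + # s xs)
    ≡⟨ sym (cong₂ _+_ (length-filterᵇ-∷ r x xs) (length-filterᵇ-∷ s x xs)) ⟩
  # r (x ∷ xs) + # s (x ∷ xs) ∎
  where
  # : (A → Bool) → List A → ℕ
  # f ys = length (filterᵇ f ys)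

bool→ℕ-∧-balance : ∀ a b c d e → bool→ℕ a + bool→ℕ b ≡ bool→ℕ c + bool→ℕ d →
  bool→ℕ (a ∧ e) + bool→ℕ (b ∧ e) ≡ bool→ℕ (c ∧ e) + bool→ℕ (d ∧ e)
bool→ℕ-∧-balance a b c d true  balance
  rewrite ∧-identityʳ a | ∧-identityʳ b | ∧-identityʳ c | ∧-identityʳ d = balance
bool→ℕ-∧-balance a b c d false _
  rewrite ∧-zeroʳ a | ∧-zeroʳ b | ∧-zeroʳ c | ∧-zeroʳ d = refl

xor-balance : ∀ s t b → s ∧ t ≡ false →
  bool→ℕ (t xor (s xor b)) + bool→ℕ b ≡ bool→ℕ (s xor b) + bool→ℕ (t xor b)
xor-balance true  true  b ()
xor-balance true  false b _ = refl
xor-balance false true  b _ = +-comm (bool→ℕ (not b)) (bool→ℕ b)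
xor-balance false false b _ = refl

module _ (G : EmbeddedGraph) where
  open EmbeddedGraph G

  _!_ : Orientation G → Fin nD → Bool
  o ! d = lookup o d

  orientation-ext : ∀ {o o' : Orientation G} → (∀ d → o ! d ≡ o' ! d) → o ≡ o'
  orientation-ext h = Pointwise-≡⇒≡ (ext h)

  !-σ : ∀ o → IsOrientation G o → ∀ d → o ! d ≡ not (o ! σ d)
  !-σ o or d = trans (sym (not-involutive (o ! d))) (cong not (sym (or d)))

  Touches : Fin nF → Fin nD → Set
  Touches i d = face d ≡ i ⊎ face (σ d) ≡ i

  touches? : ∀ i d → Dec (Touches i d)
  touches? i d = face d ≟ i ⊎-dec face (σ d) ≟ i

  touches : Fin nF → Fin nD → Bool
  touches i d = does (touches? i d)

  touches-σ : ∀ i d → touches i (σ d) ≡ touches i d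
  touches-σ i d rewrite σ-invol d = ∨-comm (does (face (σ d) ≟ i)) (does (face d ≟ i))

  EdgeDisjoint : Fin nF → Fin nF → Set
  EdgeDisjoint i j = ∀ d → Touches i d → ¬ Touches j d

  EdgeDisjoint-sym : ∀ {i j} → EdgeDisjoint i j → EdgeDisjoint j i
  EdgeDisjoint-sym disjoint d tj ti = disjoint d ti tj

  touches-∧-disjoint : ∀ {i j} → EdgeDisjoint i j → ∀ d → touches i d ∧ touches j d ≡ false
  touches-∧-disjoint {i} {j} disjoint d with touches? i d
  ... | no ¬ti = cong (_∧ touches j d) (dec-false (touches? i d) ¬ti)
  ... | yes ti =
    trans (cong (_∧ touches j d) (dec-true (touches? i d) ti)) (dec-false (touches? j d) (disjoint d ti))

  FaceDirected : Bool → Fin nF → Orientation G → Set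
  FaceDirected b i o = ∀ d → face d ≡ i → o ! d ≡ b

  directed-faces-disjoint : ∀ {b i j} o → IsOrientation G o → i ≢ j →
    FaceDirected b i o → FaceDirected b j o → EdgeDisjoint i j
  directed-faces-disjoint o or i≢j di dj d (inj₁ p) (inj₁ q) = i≢j (trans (sym p) q)
  directed-faces-disjoint o or i≢j di dj d (inj₂ p) (inj₂ q) = i≢j (trans (sym p) q)
  directed-faces-disjoint o or i≢j di dj d (inj₁ p) (inj₂ q) =
    not-¬ (dj (σ d) q) (trans (or d) (cong not (di d p)))
  directed-faces-disjoint o or i≢j di dj d (inj₂ p) (inj₁ q) =
    not-¬ (di (σ d) p) (trans (or d) (cong not (dj d q)))

  flipFace : Fin nF → Orientation G → Orientation G
  flipFace i o = tabulate λ d → touches i d xor (o ! d)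

  flipFace-! : ∀ i o d → flipFace i o ! d ≡ touches i d xor (o ! d)
  flipFace-! i o d = lookup∘tabulate _ d

  flipFace-touched : ∀ {i d} o → Touches i d → flipFace i o ! d ≡ not (o ! d)
  flipFace-touched {i} {d} o t rewrite flipFace-! i o d | dec-true (touches? i d) t = refl

  flipFace-untouched : ∀ {i d} o → ¬ Touches i d → flipFace i o ! d ≡ o ! d
  flipFace-untouched {i} {d} o ¬t rewrite flipFace-! i o d | dec-false (touches? i d) ¬t = refl

  flipFace-involutive : ∀ i o → flipFace i (flipFace i o) ≡ o
  flipFace-involutive i o = orientation-ext λ d → begin
    flipFace i (flipFace i o) ! d              ≡⟨ flipFace-! i (flipFace i o) d ⟩
    touches i d xor (flipFace i o ! d)         ≡⟨ cong (touches i d xor_) (flipFace-! i o d) ⟩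
    touches i d xor (touches i d xor (o ! d))  ≡⟨ xor-assoc (touches i d) _ _ ⟨
    (touches i d xor touches i d) xor (o ! d)  ≡⟨ cong (_xor (o ! d)) (xor-same (touches i d)) ⟩
    o ! d                                      ∎

  flipFace-comm : ∀ i j o → flipFace i (flipFace j o) ≡ flipFace j (flipFace i o)
  flipFace-comm i j o = orientation-ext λ d → begin
    flipFace i (flipFace j o) ! d              ≡⟨ flipFace-! i (flipFace j o) d ⟩
    touches i d xor (flipFace j o ! d)         ≡⟨ cong (touches i d xor_) (flipFace-! j o d) ⟩
    touches i d xor (touches j d xor (o ! d))  ≡⟨ xor-assoc (touches i d) _ _ ⟨
    (touches i d xor touches j d) xor (o ! d)  ≡⟨ cong (_xor (o ! d)) (xor-comm (touches i d) _) ⟩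
    (touches j d xor touches i d) xor (o ! d)  ≡⟨ xor-assoc (touches j d) _ _ ⟩
    touches j d xor (touches i d xor (o ! d))  ≡⟨ cong (touches j d xor_) (flipFace-! i o d) ⟨
    touches j d xor (flipFace i o ! d)         ≡⟨ flipFace-! j (flipFace i o) d ⟨
    flipFace j (flipFace i o) ! d              ∎

  flipFace-isOrientation : ∀ i o → IsOrientation G o → IsOrientation G (flipFace i o)
  flipFace-isOrientation i o or d = begin
    flipFace i o ! σ d                 ≡⟨ flipFace-! i o (σ d) ⟩
    touches i (σ d) xor (o ! σ d)      ≡⟨ cong₂ _xor_ (touches-σ i d) (or d) ⟩
    touches i d xor not (o ! d)        ≡⟨ not-distribʳ-xor (touches i d) (o ! d) ⟨
    not (touches i d xor (o ! d))      ≡⟨ cong not (flipFace-! i o d) ⟨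
    not (flipFace i o ! d)             ∎

  flipFace-reverses : ∀ {b i} o → FaceDirected b i o → FaceDirected (not b) i (flipFace i o)
  flipFace-reverses o directed d p = trans (flipFace-touched o (inj₁ p)) (cong not (directed d p))

  flipFace-preserves : ∀ {b i j} o → EdgeDisjoint i j → FaceDirected b j o → FaceDirected b j (flipFace i o)
  flipFace-preserves o disjoint directed d p =
    trans (flipFace-untouched o λ ti → disjoint d ti (inj₁ p)) (directed d p)

  flipFace-Flip : ∀ {i} o → IsCCW G i o → Flip G i o (flipFace i o)
  flipFace-Flip o ccw = ccw , flipFace-reverses o ccw , λ d p q → flipFace-untouched o [ p , q ]

  flipFace-Flip⁻ : ∀ {i} o → FaceDirected false i o → Flip G i (flipFace i o) o
  flipFace-Flip⁻ {i} o cw =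
    subst (Flip G i (flipFace i o)) (flipFace-involutive i o) (flipFace-Flip (flipFace i o) (flipFace-reverses o cw))

  Flip⇒≡flipFace : ∀ {i} o' o → IsOrientation G o' → IsOrientation G o → Flip G i o' o → o ≡ flipFace i o'
  Flip⇒≡flipFace {i} o' o or' or (ccw , cw , fixed) =
    orientation-ext λ d → reversed-or-fixed d (touches? i d)
    where
    reversed : ∀ d → Touches i d → o ! d ≡ not (o' ! d)
    reversed d (inj₁ p) rewrite cw d p | ccw d p = refl
    reversed d (inj₂ q) = begin
      o ! d                 ≡⟨ !-σ o or d ⟩
      not (o ! σ d)         ≡⟨ cong not (cw (σ d) q) ⟩
      true                  ≡⟨ cong (not ∘ not) (ccw (σ d) q) ⟨
      not (not (o' ! σ d))  ≡⟨ cong not (!-σ o' or' d) ⟨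
      not (o' ! d)          ∎
    reversed-or-fixed : ∀ d → Dec (Touches i d) → o ! d ≡ flipFace i o' ! d
    reversed-or-fixed d (yes t) = trans (reversed d t) (sym (flipFace-touched o' t))
    reversed-or-fixed d (no ¬t) = trans (fixed d (¬t ∘ inj₁) (¬t ∘ inj₂)) (sym (flipFace-untouched o' ¬t))

  Flip⇒≡flipFace⁻ : ∀ {i} o' o → IsOrientation G o' → IsOrientation G o → Flip G i o' o → o' ≡ flipFace i o
  Flip⇒≡flipFace⁻ {i} o' o or' or flip = begin
    o'                          ≡⟨ flipFace-involutive i o' ⟨
    flipFace i (flipFace i o')  ≡⟨ cong (flipFace i) (Flip⇒≡flipFace o' o or' or flip) ⟨
    flipFace i o                ∎

  outdeg-balance : ∀ {a b c e} →
    (∀ d → bool→ℕ (a ! d) + bool→ℕ (b ! d) ≡ bool→ℕ (c ! d) + bool→ℕ (e ! d)) →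
    ∀ v → outdeg G a v + outdeg G b v ≡ outdeg G c v + outdeg G e v
  outdeg-balance {a} {b} {c} {e} balance v =
    length-filterᵇ-balance _ _ _ _
      (λ d → bool→ℕ-∧-balance (a ! d) (b ! d) (c ! d) (e ! d) (does (vert d ≟ v)) (balance d))
      (allFinL nD)

  flipFace-square-isAlpha : ∀ {α i j} v → EdgeDisjoint i j →
    IsAlphaOrientation G α v → IsAlphaOrientation G α (flipFace i v) → IsAlphaOrientation G α (flipFace j v) →
    IsAlphaOrientation G α (flipFace j (flipFace i v))
  flipFace-square-isAlpha {α} {i} {j} v disjoint (_ , outv) (or-u , outu) (_ , outw) =
    flipFace-isOrientation j u or-u , λ x → +-cancelʳ-≡ (α x) _ _ (begin
      outdeg G z x + α x            ≡⟨ cong (outdeg G z x +_) (outv x) ⟨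
      outdeg G z x + outdeg G v x   ≡⟨ outdeg-balance {z} {v} {u} {w} balance x ⟩
      outdeg G u x + outdeg G w x   ≡⟨ cong₂ _+_ (outu x) (outw x) ⟩
      α x + α x                     ∎)
    where
    u w z : Orientation G
    u = flipFace i v
    w = flipFace j v
    z = flipFace j u
    balance : ∀ d → bool→ℕ (z ! d) + bool→ℕ (v ! d) ≡ bool→ℕ (u ! d) + bool→ℕ (w ! d)
    balance d rewrite flipFace-! j u d | flipFace-! i v d | flipFace-! j v d =
      xor-balance (touches i d) (touches j d) (v ! d) (touches-∧-disjoint disjoint d)

  flipGraph-isUColoring : ∀ α → IsUColoring (DEdge G α) proj₁
  flipGraph-isUColoring α {u} {v} {w} u≢w (i , av , au , flipᵢ@(ccwᵢ , _)) (j , _ , aw , flipⱼ@(ccwⱼ , _))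
    with refl ← Flip⇒≡flipFace v u (proj₁ av) (proj₁ au) flipᵢ
       | refl ← Flip⇒≡flipFace v w (proj₁ av) (proj₁ aw) flipⱼ =
    i≢j , z , (j , au , az , flipFace-Flip u (flipFace-preserves v disjoint ccwⱼ))
            , (i , aw , az , subst (Flip G i w) (flipFace-comm i j v)
                                   (flipFace-Flip w (flipFace-preserves v (EdgeDisjoint-sym disjoint) ccwᵢ)))
            , refl , refl
    where
    i≢j : i ≢ j
    i≢j refl = u≢w refl
    disjoint : EdgeDisjoint i j
    disjoint = directed-faces-disjoint v (proj₁ av) i≢j ccwᵢ ccwⱼ
    z : Orientation G
    z = flipFace j u
    az : IsAlphaOrientation G α z
    az = flipFace-square-isAlpha v disjoint av au aw

  flipGraph-isLColoring : ∀ α → IsLColoring (DEdge G α) proj₁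
  flipGraph-isLColoring α {u} {v} {w} u≢w (i , au , av , flipᵢ@(_ , cwᵢ , _)) (j , aw , _ , flipⱼ@(_ , cwⱼ , _))
    with refl ← Flip⇒≡flipFace⁻ u v (proj₁ au) (proj₁ av) flipᵢ
       | refl ← Flip⇒≡flipFace⁻ w v (proj₁ aw) (proj₁ av) flipⱼ =
    i≢j , z , (j , az , au , flipFace-Flip⁻ u (flipFace-preserves v disjoint cwⱼ))
            , (i , az , aw , subst (λ x → Flip G i x w) (flipFace-comm i j v)
                                   (flipFace-Flip⁻ w (flipFace-preserves v (EdgeDisjoint-sym disjoint) cwᵢ)))
            , refl , refl
    where
    i≢j : i ≢ j
    i≢j refl = u≢w refl
    disjoint : EdgeDisjoint i j
    disjoint = directed-faces-disjoint v (proj₁ av) i≢j cwᵢ cwⱼ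
    z : Orientation G
    z = flipFace j u
    az : IsAlphaOrientation G α z
    az = flipFace-square-isAlpha v disjoint av au aw

-- The vertices
-- are passed explicitly since an orientation cannot be inferred from its lookups.
proposition4p2 : (G : EmbeddedGraph) (α : Fin (EmbeddedGraph.nV G) → ℕ) →
    StronglyConnectedα G α →
    IsUColoring (DEdge G α) proj₁ × IsLColoring (DEdge G α) proj₁
proposition4p2 G α _ =
  (λ {u v w} → flipGraph-isUColoring G α {u} {v} {w}) , (λ {u v w} → flipGraph-isLColoring G α {u} {v} {w})
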